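{- For any statement $s$, state predicate $U$ and setoid trace predicate $P$, if $\{U\}\,s\,\{P\}$ is derivable in the trace-based Hoare logic, then $\{U\}\,s\,\{\mathrm{Last}(P)\}$ is derivable in the state-based partial-correctness Hoare logic.
   Context: While statements: $s ::= x:=e \mid \mathsf{skip}\mid s_0;s_1\mid \mathsf{if}\ e\ \mathsf{then}\ s_t\ \mathsf{else}\ s_f\mid \mathsf{while}\ e\ \mathsf{do}\ s_t$; a state $\sigma$ assigns integers to variables, $[\![e]\!]\sigma$ is the value of $e$, $\sigma\models e$ means $e$ is true in $\sigma$. The metatheory is constructive. Traces are coinductive: $\langle\sigma\rangle$, and $\sigma::\tau$ for a trace $\tau$; bisimilarity $\approx$ is coinductive; $\mathit{hd}\langle\sigma\rangle=\mathit{hd}(\sigma::\tau)=\sigma$; $\tau\downarrow\sigma$ is inductive: $\langle\sigma\rangle\downarrow\sigma$, $\sigma::\tau\downarrow\sigma'$ if $\tau\downarrow\sigma'$. State predicates are arbitrary; trace predicates are setoid predicates (invariant under $\approx$); $\mathsf{true},\wedge,\neg,\exists$ are pointwise; $\models$ is entailment. $\langle U\rangle$ holds exactly of $\langle\sigma\rangle$ with $\sigma\models U$; $\mathrm{dup}(U)$ exactly of $\sigma::\langle\sigma\rangle$ with $\sigma\models U$; $U[x\mapsto e]$ exactly of $\sigma::\langle\sigma[x\mapsto[\![e]\!]\sigma]\rangle$ with $\sigma\models U$. $\mathrm{follows}_Q(\tau,\tau')$ is coinductive: $\mathrm{follows}_Q(\langle\sigma\rangle,\tau)$ if $\mathit{hd}\,\tau=\sigma$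 and $\tau\models Q$; $\mathrm{follows}_Q(\sigma::\tau,\sigma::\tau')$ if $\mathrm{follows}_Q(\tau,\tau')$. $\tau'\models P\ast\ast Q$ iff $\exists\tau$, $\tau\models P$ and $\mathrm{follows}_Q(\tau,\tau')$ (chains associate to the right). $P^{\dagger}$ is coinductive: $\tau\models P^{\dagger}$ if $\tau\models\langle\mathsf{true}\rangle$; $\tau'\models P^{\dagger}$ if $\exists\tau$, $\tau\models P$ and $\mathrm{follows}_{P^{\dagger}}(\tau,\tau')$. $\mathrm{Last}(P)$ is the state predicate holding of $\sigma$ iff some $\tau\models P$ has $\tau\downarrow\sigma$. The trace-based Hoare logic derives $\{U\}\,s\,\{P\}$ inductively by: $\{U\}\,x:=e\,\{U[x\mapsto e]\}$; $\{U\}\,\mathsf{skip}\,\{\langle U\rangle\}$; from $\{U\}\,s_0\,\{P\ast\ast\langle V\rangle\}$ and $\{V\}\,s_1\,\{Q\}$ infer $\{U\}\,s_0;s_1\,\{P\ast\ast Q\}$; from $\{e\wedge U\}\,s_t\,\{P\}$ and $\{\neg e\wedge U\}\,s_f\,\{P\}$ infer $\{U\}\,\mathsf{if}\ e\ \mathsf{then}\ s_t\ \mathsf{else}\ s_f\,\{\mathrm{dup}(U)\ast\ast P\}$; from $U\models I$ and $\{e\wedge I\}\,s_t\,\{P\ast\ast\langle I\rangle\}$ infer $\{U\}\,\mathsf{while}\ e\ \mathsf{do}\ s_t\,\{\mathrm{dup}(U)\ast\ast(P\ast\ast\mathrm{dup}(I))^{\dagger}\ast\ast\langle\neg e\rangle\}$;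 from $U\models U'$, $\{U'\}\,s\,\{P'\}$, $P'\models P$ infer $\{U\}\,s\,\{P\}$; from $\forall z.\ \{U_z\}\,s\,\{P_z\}$ infer $\{\exists z.U_z\}\,s\,\{\exists z.P_z\}$. The state-based partial-correctness Hoare logic derives $\{U\}\,s\,\{Z\}$ inductively by: $\{U[e/x]\}\,x:=e\,\{U\}$ where $U[e/x]$ holds of $\sigma$ iff $U$ holds of $\sigma[x\mapsto[\![e]\!]\sigma]$; $\{U\}\,\mathsf{skip}\,\{U\}$; from $\{U\}\,s_0\,\{V\}$, $\{V\}\,s_1\,\{Z\}$ infer $\{U\}\,s_0;s_1\,\{Z\}$; from $\{e\wedge U\}\,s_t\,\{Z\}$, $\{\neg e\wedge U\}\,s_f\,\{Z\}$ infer $\{U\}\,\mathsf{if}\ e\ \mathsf{then}\ s_t\ \mathsf{else}\ s_f\,\{Z\}$; from $\{e\wedge I\}\,s_t\,\{I\}$ infer $\{I\}\,\mathsf{while}\ e\ \mathsf{do}\ s_t\,\{I\wedge\neg e\}$; from $\forall z.\{U_z\}\,s\,\{V_z\}$ infer $\{\exists z.U_z\}\,s\,\{\exists z.V_z\}$; from $U\models U'$, $\{U'\}\,s\,\{Z'\}$, $Z'\models Z$ infer $\{U\}\,s\,\{Z\}$. -}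

module Defs where

open import Data.Nat using (ℕ; zero; suc) renaming (_≟_ to _≟ℕ_)
open import Data.Integer using (ℤ; _+_; _-_; _*_; 0ℤ; 1ℤ) renaming (_<?_ to _<ℤ?_; _≟_ to _≟ℤ_)
open import Data.Product using (Σ; _×_; _,_; proj₁; proj₂)
open import Data.Sum using (_⊎_; inj₁; inj₂)
open import Data.Maybe using (Maybe; just; nothing)
open import Level using (Lift; lift; _⊔_) renaming (suc to lsuc; zero to lzero)
open import Data.Unit using (⊤; tt)
open import Relation.Nullary using (¬_; yes; no)
open import Relation.Binary.PropositionalEquality using (_≡_; _≢_; refl; sym; trans; cong; subst)

Var : Set
Var = ℕ

data Exp : Set where
  lit  : ℤ → Exp
  var  : Var → Exp
  _⊕_  : Exp → Exp → Exp
  _⊖_  : Exp → Exp → Exp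
  _⊗_  : Exp → Exp → Exp
  _≐_  : Exp → Exp → Exp
  _⋖_  : Exp → Exp → Exp
  !_   : Exp → Exp

data Stmt : Set where
  _≔_      : Var → Exp → Stmt
  skip     : Stmt
  _⨾_      : Stmt → Stmt → Stmt
  if_then_else_ : Exp → Stmt → Stmt → Stmt
  while_loop_ : Exp → Stmt → Stmt

State : Set
State = Var → ℤ

update : State → Var → ℤ → State
update σ x v y with x ≟ℕ y
... | yes _ = v
... | no  _ = σ y

-- booleans are encoded as integers: 0 is false, everything else true
⟦_⟧ : Exp → State → ℤ
⟦ lit n ⟧ σ = n
⟦ var x ⟧ σ = σ x
⟦ e₁ ⊕ e₂ ⟧ σ = ⟦ e₁ ⟧ σ + ⟦ e₂ ⟧ σ
⟦ e₁ ⊖ e₂ ⟧ σ = ⟦ e₁ ⟧ σ - ⟦ e₂ ⟧ σ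
⟦ e₁ ⊗ e₂ ⟧ σ = ⟦ e₁ ⟧ σ * ⟦ e₂ ⟧ σ
⟦ e₁ ≐ e₂ ⟧ σ with ⟦ e₁ ⟧ σ ≟ℤ ⟦ e₂ ⟧ σ
... | yes _ = 1ℤ
... | no  _ = 0ℤ
⟦ e₁ ⋖ e₂ ⟧ σ with ⟦ e₁ ⟧ σ <ℤ? ⟦ e₂ ⟧ σ
... | yes _ = 1ℤ
... | no  _ = 0ℤ
⟦ ! e ⟧ σ with ⟦ e ⟧ σ ≟ℤ 0ℤ
... | yes _ = 1ℤ
... | no  _ = 0ℤ

_⊨ₑ_ : State → Exp → Set
σ ⊨ₑ e = ⟦ e ⟧ σ ≢ 0ℤ

-- State predicates (arbitrary; valued in Set₁ so that Last(P) is one)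

SPred : Set₂
SPred = State → Set₁

_⊨ˢ_ : SPred → SPred → Set₁
U ⊨ˢ V = ∀ σ → U σ → V σ

trueˢ : SPred
trueˢ _ = Lift (lsuc lzero) ⊤

_∧ˢ_ : Exp → SPred → SPred
(e ∧ˢ U) σ = Lift (lsuc lzero) (σ ⊨ₑ e) × U σ

¬ˢ_∧ˢ_ : Exp → SPred → SPred
(¬ˢ e ∧ˢ U) σ = Lift (lsuc lzero) (¬ (σ ⊨ₑ e)) × U σ

¬ₑ : Exp → SPred
¬ₑ e σ = Lift (lsuc lzero) (¬ (σ ⊨ₑ e))

∃ˢ : (Z : Set) → (Z → SPred) → SPred
∃ˢ Z U σ = Σ Z λ z → U z σ

_∧¬ˢ_ : SPred → Exp → SPred
(U ∧¬ˢ e) σ = U σ × Lift (lsuc lzero) (¬ (σ ⊨ₑ e))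

_[_/_] : SPred → Exp → Var → SPred
(U [ e / x ]) σ = U (update σ x (⟦ e ⟧ σ))

-- Traces: nonempty, possibly infinite sequences of states.
-- Without --guardedness (forbidden here) coinductive types are encoded:
-- a trace is its head state together with the (possibly empty, possibly
-- infinite) sequence of remaining states, given as a prefix-closed
-- partial function ℕ → Maybe State.

record Trace : Set where
  field
    hd     : State
    tl     : ℕ → Maybe State
    closed : ∀ n → tl n ≡ nothing → tl (suc n) ≡ nothing

open Trace public

⟨_⟩ : State → Trace
hd ⟨ σ ⟩ = σ
tl ⟨ σ ⟩ _ = nothing
closed ⟨ σ ⟩ _ _ = refl

_∷_ : State → Trace → Trace
hd (σ ∷ τ) = σ
tl (σ ∷ τ) zero = just (hd τ)
tl (σ ∷ τ) (suc n) = tl τ n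
closed (σ ∷ τ) zero ()
closed (σ ∷ τ) (suc n) e = closed τ n e

-- the tail of a trace whose second state is σ'
rest : State → Trace → Trace
hd (rest σ' τ) = σ'
tl (rest σ' τ) n = tl τ (suc n)
closed (rest σ' τ) n e = closed τ (suc n) e

-- bisimilarity (on this encoding: same head and pointwise equal tails)
_≈_ : Trace → Trace → Set
τ ≈ τ' = (hd τ ≡ hd τ') × (∀ n → tl τ n ≡ tl τ' n)

data _↓_ : Trace → State → Set where
  ↓⟨⟩ : ∀ {τ} → tl τ 0 ≡ nothing → τ ↓ hd τ
  ↓∷  : ∀ {τ σ' σ} → tl τ 0 ≡ just σ' → rest σ' τ ↓ σ → τ ↓ σ

record TPred : Set₂ where
  field
    pred : Trace → Set₁
    resp : ∀ {τ τ'} → τ ≈ τ' → pred τ → pred τ'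

open TPred public

_⊨ᵗ_ : TPred → TPred → Set₁
P ⊨ᵗ Q = ∀ τ → pred P τ → pred Q τ

-- follows_Q as a greatest fixed point: the union of all post-fixed points
-- of its defining operator FollowsF.
FollowsF : ∀ {ℓ} → (Trace → Set ℓ) → (Trace → Trace → Set) → Trace → Trace → Set ℓ
FollowsF {ℓ} Q R τ τ' =
  -- follows_Q(⟨σ⟩, τ') if hd τ' = σ and τ' ⊨ Q
  (tl τ 0 ≡ nothing × Lift ℓ (hd τ' ≡ hd τ) × Q τ')
  -- follows_Q(σ::ρ, σ::ρ') if follows_Q(ρ, ρ')
  ⊎ Lift ℓ (hd τ ≡ hd τ' × Σ State λ σ₁ → Σ State λ σ₂ →
       tl τ 0 ≡ just σ₁ × tl τ' 0 ≡ just σ₂ × R (rest σ₁ τ) (rest σ₂ τ'))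

Follows : ∀ {ℓ} → (Trace → Set ℓ) → Trace → Trace → Set (lsuc lzero ⊔ ℓ)
Follows Q τ τ' = Σ (Trace → Trace → Set) λ R →
  R τ τ' × (∀ a b → R a b → FollowsF Q R a b)

follows-resp : ∀ {ℓ ℓ'} {Q : Trace → Set ℓ} {Q' : Trace → Set ℓ'} →
  (∀ {x y} → x ≈ y → Q x → Q' y) →
  ∀ {τ x y} → x ≈ y → Follows Q τ x → Follows Q' τ y
follows-resp {Q = Q} {Q'} Qr {τ} {x} {y} xy (R , r , post) =
  R' , (x , r , xy) , post'
  where
  R' : Trace → Trace → Set
  R' a c = Σ Trace λ b → R a b × b ≈ c
  post' : ∀ a c → R' a c → FollowsF Q' R' a c
  post' a c (b , rab , bc) with post a b rab
  ... | inj₁ (t0 , lift hb , qb) = inj₁ (t0 , lift (trans (sym (proj₁ bc)) hb) , Qr bc qb)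
  ... | inj₂ (lift (ha , σ₁ , σ₂ , ea , eb , rr)) =
    inj₂ (lift (trans ha (proj₁ bc) , σ₁ , σ₂ , ea , trans (sym (proj₂ bc 0)) eb ,
      (rest σ₂ b , rr , (refl , λ n → proj₂ bc (suc n)))))

⟪_⟫ : SPred → TPred
pred ⟪ U ⟫ τ = Lift (lsuc lzero) (tl τ 0 ≡ nothing) × U (hd τ)
resp ⟪ U ⟫ {τ} {τ'} (h , t) (lift e , u) =
  lift (trans (sym (t 0)) e) , subst U h u

dupᵗ : SPred → TPred
pred (dupᵗ U) τ = U (hd τ) × Lift (lsuc lzero) (tl τ 0 ≡ just (hd τ) × tl τ 1 ≡ nothing)
resp (dupᵗ U) (h , t) (u , lift (e₀ , e₁)) =
  subst U h u , lift (trans (sym (t 0)) (trans e₀ (cong just h)) , trans (sym (t 1)) e₁)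

_[_↦_] : SPred → Var → Exp → TPred
pred (U [ x ↦ e ]) τ =
  U (hd τ) × Lift (lsuc lzero) (tl τ 0 ≡ just (update (hd τ) x (⟦ e ⟧ (hd τ))) × tl τ 1 ≡ nothing)
resp (U [ x ↦ e ]) (h , t) (u , lift (e₀ , e₁)) =
  subst U h u ,
  lift (trans (sym (t 0)) (trans e₀ (cong (λ σ → just (update σ x (⟦ e ⟧ σ))) h)) ,
        trans (sym (t 1)) e₁)

∃ᵗ : (Z : Set) → (Z → TPred) → TPred
pred (∃ᵗ Z P) τ = Σ Z λ z → pred (P z) τ
resp (∃ᵗ Z P) b (z , p) = z , resp (P z) b p

infixr 5 _**_
_**_ : TPred → TPred → TPred
pred (P ** Q) τ' = Σ Trace λ τ → pred P τ × Follows (pred Q) τ τ'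
resp (P ** Q) b (τ , p , f) = τ , p , follows-resp (resp Q) b f

-- P† as a greatest fixed point (union of post-fixed points)
DaggerF : TPred → (Trace → Set) → Trace → Set₁
DaggerF P D τ' = pred ⟪ trueˢ ⟫ τ' ⊎ Σ Trace λ τ → pred P τ × Follows D τ τ'

_† : TPred → TPred
pred (P †) τ = Σ (Trace → Set) λ D → D τ × (∀ a → D a → DaggerF P D a)
resp (P †) {τ} {τ'} ττ' (D , d , post) = D' , (τ , d , ττ') , post'
  where
  D' : Trace → Set
  D' a = Σ Trace λ b → D b × b ≈ a
  post' : ∀ a → D' a → DaggerF P D' a
  post' a (b , db , ba) with post b db
  ... | inj₁ x = inj₁ (resp (⟪ trueˢ ⟫) {b} {a} ba x)
  ... | inj₂ (τ₀ , p , f) =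
    inj₂ (τ₀ , p , follows-resp (λ {x} {y} xy dx → x , dx , xy) ba f)

Last : TPred → SPred
Last P σ = Σ Trace λ τ → pred P τ × τ ↓ σ

data ⊢ᵗ[_]_[_] : SPred → Stmt → TPred → Set₂ where
  assignᵗ : ∀ {U x e} → ⊢ᵗ[ U ] (x ≔ e) [ U [ x ↦ e ] ]
  skipᵗ   : ∀ {U} → ⊢ᵗ[ U ] skip [ ⟪ U ⟫ ]
  seqᵗ    : ∀ {U V P Q s₀ s₁} → ⊢ᵗ[ U ] s₀ [ P ** ⟪ V ⟫ ] → ⊢ᵗ[ V ] s₁ [ Q ] →
            ⊢ᵗ[ U ] (s₀ ⨾ s₁) [ P ** Q ]
  ifᵗ     : ∀ {U P e sₜ s_f} → ⊢ᵗ[ e ∧ˢ U ] sₜ [ P ] → ⊢ᵗ[ ¬ˢ e ∧ˢ U ] s_f [ P ] →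
            ⊢ᵗ[ U ] (if e then sₜ else s_f) [ dupᵗ U ** P ]
  whileᵗ  : ∀ {U I P e sₜ} → U ⊨ˢ I → ⊢ᵗ[ e ∧ˢ I ] sₜ [ P ** ⟪ I ⟫ ] →
            ⊢ᵗ[ U ] (while e loop sₜ) [ dupᵗ U ** ((P ** dupᵗ I) †) ** ⟪ ¬ₑ e ⟫ ]
  conseqᵗ : ∀ {U U' P P' s} → U ⊨ˢ U' → ⊢ᵗ[ U' ] s [ P' ] → P' ⊨ᵗ P → ⊢ᵗ[ U ] s [ P ]
  existsᵗ : ∀ {Z : Set} {U : Z → SPred} {P : Z → TPred} {s} →
            (∀ z → ⊢ᵗ[ U z ] s [ P z ]) → ⊢ᵗ[ ∃ˢ Z U ] s [ ∃ᵗ Z P ]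

data ⊢ˢ[_]_[_] : SPred → Stmt → SPred → Set₂ where
  assignˢ : ∀ {U x e} → ⊢ˢ[ U [ e / x ] ] (x ≔ e) [ U ]
  skipˢ   : ∀ {U} → ⊢ˢ[ U ] skip [ U ]
  seqˢ    : ∀ {U V Z s₀ s₁} → ⊢ˢ[ U ] s₀ [ V ] → ⊢ˢ[ V ] s₁ [ Z ] → ⊢ˢ[ U ] (s₀ ⨾ s₁) [ Z ]
  ifˢ     : ∀ {U Z e sₜ s_f} → ⊢ˢ[ e ∧ˢ U ] sₜ [ Z ] → ⊢ˢ[ ¬ˢ e ∧ˢ U ] s_f [ Z ] →
            ⊢ˢ[ U ] (if e then sₜ else s_f) [ Z ]
  whileˢ  : ∀ {I e sₜ} → ⊢ˢ[ e ∧ˢ I ] sₜ [ I ] → ⊢ˢ[ I ] (while e loop sₜ) [ I ∧¬ˢ e ]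
  existsˢ : ∀ {Z : Set} {U V : Z → SPred} {s} →
            (∀ z → ⊢ˢ[ U z ] s [ V z ]) → ⊢ˢ[ ∃ˢ Z U ] s [ ∃ˢ Z V ]
  conseqˢ : ∀ {U U' Z Z' s} → U ⊨ˢ U' → ⊢ˢ[ U' ] s [ Z' ] → Z' ⊨ˢ Z → ⊢ˢ[ U ] s [ Z ]

-- Last P ignores the initial state of the traces in P, and a
-- state-based derivation cannot remember it either.  So we prove a
-- stronger, "rooted" soundness statement: for every initial state σ₀,
--   ⊢ˢ[ σ = σ₀ ∧ U ] s [ some τ ⊨ P starts in σ₀ and ends in σ ].
-- The corollary then follows by the existential rule over σ₀.
--
-- Sub-derivations started in an
-- intermediate state σ₁ are combined with the existential rule over σ₁ and
-- a frame rule for constant propositions.  For while, the state invariant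
-- is I together with a continuation saying that every finished iteration
-- trace from the current state extends the trace built so far.
module Submission where

open import Defs
open import Data.Nat using (suc)
open import Data.Product using (Σ; _×_; _,_; proj₁; proj₂)
open import Data.Sum using (_⊎_; inj₁; inj₂)
open import Data.Maybe using (nothing)
open import Data.Maybe.Properties using (just-injective)
open import Data.Unit using (tt)
open import Relation.Nullary using (¬_)
open import Level using (Lift; lift) renaming (suc to lsuc; zero to lzero)
open import Relation.Binary.PropositionalEquality using (_≡_; refl; sym; trans; subst)

≈-refl : ∀ {τ} → τ ≈ τ
≈-refl = refl , λ _ → refl

≈-trans : ∀ {a b c} → a ≈ b → b ≈ c → a ≈ c
≈-trans (h , t) (h' , t') = trans h h' , λ n → trans (t n) (t' n)

-- append d ρ: the finite trace τ (with τ ↓ σ witnessed by d) followed by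
-- ρ, where ρ is meant to start in σ; the shared state σ occurs once.
append : ∀ {τ σ} → τ ↓ σ → Trace → Trace
append (↓⟨⟩ _) ρ = ρ
append {τ} (↓∷ _ d) ρ = hd τ ∷ append d ρ

append-hd : ∀ {τ σ ρ} (d : τ ↓ σ) → hd ρ ≡ σ → hd (append d ρ) ≡ hd τ
append-hd (↓⟨⟩ _) h = h
append-hd (↓∷ _ _) h = refl

append-↓ : ∀ {τ σ ρ σ'} (d : τ ↓ σ) → ρ ↓ σ' → append d ρ ↓ σ'
append-↓ (↓⟨⟩ _) r = r
append-↓ (↓∷ _ d) r = ↓∷ refl (append-↓ d r)

-- τ is followed by 'append d ρ' whenever ρ satisfies the setoid predicate Q.
-- The witnessing relation pairs every suffix of τ with the matching suffix.
append-follows : ∀ {ℓ} (Q : Trace → Set ℓ) (Q-resp : ∀ {x y} → x ≈ y → Q x → Q y) →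
  ∀ {τ σ ρ} (d : τ ↓ σ) → Q ρ → hd ρ ≡ σ → Follows Q τ (append d ρ)
append-follows Q Q-resp {τ} {σ} {ρ} d q h = R , (σ , d , h , ≈-refl {append d ρ}) , step
  where
  R : Trace → Trace → Set
  R a b = Σ State λ σ' → Σ (a ↓ σ') λ d' → (hd ρ ≡ σ') × (append d' ρ ≈ b)
  step : ∀ a b → R a b → FollowsF Q R a b
  step a b (_ , ↓⟨⟩ t₀ , h' , eq) = inj₁ (t₀ , lift (trans (sym (proj₁ eq)) h') , Q-resp eq q)
  step a b (σ' , ↓∷ {σ' = σ₁} e d' , h' , eq) =
    inj₂ (lift (proj₁ eq , σ₁ , hd (append d' ρ) , e , sym (proj₂ eq 0) ,
      (σ' , d' , h' , (refl , λ n → proj₂ eq (suc n)))))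

append-chop : ∀ {P Q τ σ ρ} → pred P τ → (d : τ ↓ σ) → pred Q ρ → hd ρ ≡ σ →
  pred (P ** Q) (append d ρ)
append-chop {P} {Q} {τ} p d q h = τ , p , append-follows (pred Q) (resp Q) d q h

-- By
-- induction on τ' ↓ σ; the mismatched cases (one trace stops, the other
-- continues) contradict the tail equations.
follows-last : ∀ {V τ τ' σ} → Follows (pred ⟪ V ⟫) τ τ' → τ' ↓ σ →
  (τ ↓ σ) × V σ × (hd τ ≡ hd τ')
follows-last {V} {τ} (R , r , step) (↓⟨⟩ t') with step _ _ r
... | inj₁ (t₀ , lift same-hd , (_ , v)) =
  subst (τ ↓_) (sym same-hd) (↓⟨⟩ t₀) , v , sym same-hd
... | inj₂ (lift (_ , _ , _ , _ , e₂ , _)) with trans (sym t') e₂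
...   | ()
follows-last {V} (R , r , step) (↓∷ e₃ d'') with step _ _ r
... | inj₁ (_ , _ , (lift t₀' , _)) with trans (sym t₀') e₃
...   | ()
follows-last {V} (R , r , step) (↓∷ e₃ d'')
    | inj₂ (lift (same-hd , _ , _ , e₁ , e₂ , r')) =
  let same-second = just-injective (trans (sym e₂) e₃)
      (d₁ , v , _) = follows-last {V}
        (follows-resp (λ {x} {y} → resp ⟪ V ⟫ {x} {y}) (same-second , λ _ → refl)
          (R , r' , step))
        d''
  in ↓∷ e₁ d₁ , v , same-hd

dagger-nil : ∀ {Q σ} → pred (Q †) ⟨ σ ⟩
dagger-nil = (λ a → tl a 0 ≡ nothing) , refl , λ a t → inj₁ (lift t , lift tt)

-- One more iteration in front: a Q-trace c ending in σ glued to a Q†-trace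
-- starting in σ is again a Q†-trace.  The new post-fixed point adds the
-- glued trace (up to ≈) to the old one.
dagger-cons : ∀ {Q c σ τ} → pred Q c → (dc : c ↓ σ) → pred (Q †) τ → hd τ ≡ σ →
  pred (Q †) (append dc τ)
dagger-cons {Q} {c} {σ} {τ} qc dc (D , dτ , unfold) h =
  D' , inj₂ (≈-refl {append dc τ}) , unfold'
  where
  D' : Trace → Set
  D' a = (Σ Trace λ b → D b × b ≈ a) ⊎ (append dc τ ≈ a)
  D'-resp : ∀ {x y} → x ≈ y → D' x → D' y
  D'-resp {x} {y} xy (inj₁ (b , db , bx)) = inj₁ (b , db , ≈-trans {b} {x} {y} bx xy)
  D'-resp {x} {y} xy (inj₂ e) = inj₂ (≈-trans {append dc τ} {x} {y} e xy)
  unfold' : ∀ a → D' a → DaggerF Q D' a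
  unfold' a (inj₁ (b , db , ba)) with unfold b db
  ... | inj₁ nil = inj₁ (resp ⟪ trueˢ ⟫ {b} {a} ba nil)
  ... | inj₂ (τ₀ , q , f) = inj₂ (τ₀ , q , follows-resp (λ xy dx → inj₁ (_ , dx , xy)) ba f)
  unfold' a (inj₂ eq) =
    inj₂ (c , qc , follows-resp {Q = D'} (λ {x} {y} → D'-resp {x} {y}) {c} eq
      (append-follows D' (λ {x} {y} → D'-resp {x} {y}) dc (inj₁ (τ , dτ , ≈-refl {τ})) h))

-- Frame rule for a constant proposition in the state-based logic: it lets a
-- derivation started in an intermediate state remember facts about the past.
frame : ∀ {U Z s} (K : Set₁) → ⊢ˢ[ U ] s [ Z ] →
  ⊢ˢ[ (λ σ → K × U σ) ] s [ (λ σ → K × Z σ) ]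
frame K assignˢ = assignˢ
frame K skipˢ = skipˢ
frame K (seqˢ d₀ d₁) = seqˢ (frame K d₀) (frame K d₁)
frame K (ifˢ dₜ d_f) =
  ifˢ (conseqˢ (λ σ (b , k , u) → k , b , u) (frame K dₜ) (λ _ z → z))
      (conseqˢ (λ σ (b , k , u) → k , b , u) (frame K d_f) (λ _ z → z))
frame K (whileˢ d) =
  conseqˢ (λ _ z → z)
    (whileˢ (conseqˢ (λ σ (b , k , i) → k , b , i) (frame K d) (λ _ z → z)))
    (λ σ ((k , i) , b) → k , i , b)
frame K (existsˢ d) =
  conseqˢ (λ σ (k , z , u) → z , k , u) (existsˢ (λ z → frame K (d z)))
    (λ σ (z , k , v) → k , z , v)
frame K (conseqˢ f d g) =
  conseqˢ (λ σ (k , u) → k , f σ u) (frame K d) (λ σ (k , z) → k , g σ z)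

At : SPred → State → SPred
At U σ₀ σ = Lift (lsuc lzero) (σ ≡ σ₀) × U σ

LastFrom : TPred → State → SPred
LastFrom P σ₀ σ = Σ Trace λ τ → pred P τ × Lift (lsuc lzero) (hd τ ≡ σ₀) × τ ↓ σ

-- The rooted state-based reading of a trace-based triple.
-- (A record, so that U, s and P can be inferred from it.)
record Rooted (U : SPred) (s : Stmt) (P : TPred) : Set₂ where
  field
    from : ∀ σ₀ → ⊢ˢ[ At U σ₀ ] s [ LastFrom P σ₀ ]

open Rooted

via-midpoint : ∀ {Pre : TPred} {V Z : SPred} {Q : TPred} {s σ₀} →
  (∀ σ → LastFrom Pre σ₀ σ → V σ) → Rooted V s Q →
  (∀ σ σ₁ → LastFrom Pre σ₀ σ₁ → LastFrom Q σ₁ σ → Z σ) →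
  ⊢ˢ[ LastFrom Pre σ₀ ] s [ Z ]
via-midpoint {Pre} {σ₀ = σ₀} here d there =
  conseqˢ (λ σ lf → σ , lf , lift refl , here σ lf)
    (existsˢ {Z = State} (λ σ₁ → frame (LastFrom Pre σ₀ σ₁) (from d σ₁)))
    (λ σ (σ₁ , lf₁ , lf) → there σ σ₁ lf₁ lf)

rooted-assign : ∀ {U x e} → Rooted U (x ≔ e) (U [ x ↦ e ])
from (rooted-assign {U} {x} {e}) σ₀ = conseqˢ witness assignˢ (λ _ z → z)
  where
  witness : ∀ σ → At U σ₀ σ → LastFrom (U [ x ↦ e ]) σ₀ (update σ x (⟦ e ⟧ σ))
  witness σ (lift eq , u) =
    σ ∷ ⟨ update σ x (⟦ e ⟧ σ) ⟩ , (u , lift (refl , refl)) , lift eq , ↓∷ refl (↓⟨⟩ refl)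

rooted-skip : ∀ {U} → Rooted U skip ⟪ U ⟫
from rooted-skip σ₀ =
  conseqˢ (λ σ (lift eq , u) → ⟨ σ ⟩ , (lift refl , u) , lift eq , ↓⟨⟩ refl) skipˢ (λ _ z → z)

-- The first part ends in a V-state σ₁ where the second part is started;
-- the result is the first trace with the second appended.
rooted-seq : ∀ {U V P Q s₀ s₁} → Rooted U s₀ (P ** ⟪ V ⟫) → Rooted V s₁ Q →
  Rooted U (s₀ ⨾ s₁) (P ** Q)
from (rooted-seq {V = V} {P} {Q} d₀ d₁) σ₀ =
  seqˢ (from d₀ σ₀) (via-midpoint {P ** ⟪ V ⟫} {V} start d₁ glue)
  where
  start : ∀ σ → LastFrom (P ** ⟪ V ⟫) σ₀ σ → V σ
  start σ (_ , (_ , _ , fol) , _ , d) = proj₁ (proj₂ (follows-last {V} fol d))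
  glue : ∀ σ σ₁ → LastFrom (P ** ⟪ V ⟫) σ₀ σ₁ → LastFrom Q σ₁ σ → LastFrom (P ** Q) σ₀ σ
  glue σ σ₁ (_ , (τ , p , fol) , lift h , d) (ρ , q , lift hρ , dρ)
    with follows-last {V} fol d
  ... | (dτ , _ , same-hd) =
    append dτ ρ , append-chop {P} {Q} p dτ q hρ ,
    lift (trans (append-hd dτ hρ) (trans same-hd h)) , append-↓ dτ dρ

dup-↓ : ∀ σ → (σ ∷ ⟨ σ ⟩) ↓ σ
dup-↓ σ = ↓∷ refl (↓⟨⟩ refl)

prepend-dup : ∀ {U P σ₀ σ} → U σ₀ → LastFrom P σ₀ σ → LastFrom (dupᵗ U ** P) σ₀ σ
prepend-dup {U} {P} {σ₀} u₀ (τ , p , lift hτ , dτ) =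
  append (dup-↓ σ₀) τ , append-chop {dupᵗ U} {P} (u₀ , lift (refl , refl)) (dup-↓ σ₀) p hτ ,
  lift (append-hd {ρ = τ} (dup-↓ σ₀) hτ) , append-↓ (dup-↓ σ₀) dτ

-- Both branches are started in σ₀ itself; U σ₀ is carried along by framing.
rooted-if : ∀ {U P e sₜ s_f} → Rooted (e ∧ˢ U) sₜ P → Rooted (¬ˢ e ∧ˢ U) s_f P →
  Rooted U (if e then sₜ else s_f) (dupᵗ U ** P)
from (rooted-if {U} {P} {e} dₜ d_f) σ₀ =
  ifˢ (conseqˢ (branch (λ σ → σ ⊨ₑ e)) (frame (U σ₀) (from dₜ σ₀)) stutter)
      (conseqˢ (branch (λ σ → ¬ (σ ⊨ₑ e))) (frame (U σ₀) (from d_f σ₀)) stutter)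
  where
  branch : (A : State → Set) → ∀ σ → Lift (lsuc lzero) (A σ) × At U σ₀ σ →
    U σ₀ × At (λ σ' → Lift (lsuc lzero) (A σ') × U σ') σ₀ σ
  branch A σ (a , lift eq , u) = subst U eq u , lift eq , a , u
  stutter : ∀ σ → U σ₀ × LastFrom P σ₀ σ → LastFrom (dupᵗ U ** P) σ₀ σ
  stutter σ (u₀ , lf) = prepend-dup {U} {P} u₀ lf

module WhileCase {U I : SPred} {P : TPred} {e : Exp} {sₜ : Stmt}
  (U⊨I : U ⊨ˢ I) (body : Rooted (e ∧ˢ I) sₜ (P ** ⟪ I ⟫)) (σ₀ : State) where

  Iteration : TPred
  Iteration = P ** dupᵗ I

  Loop : TPred
  Loop = dupᵗ U ** (Iteration †) ** ⟪ ¬ₑ e ⟫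

  -- Every sequence of iterations from σ that stops in a state violating e
  -- completes a loop trace from σ₀ (the past iterations are built in).
  Continues : SPred
  Continues σ = ∀ τ → pred (Iteration †) τ → hd τ ≡ σ →
    ∀ σ' → τ ↓ σ' → ¬ₑ e σ' → LastFrom Loop σ₀ σ'

  Invariant : SPred
  Invariant σ = I σ × Continues σ

  -- On entry the past is just the stutter step at σ₀.
  entry : ∀ σ → At U σ₀ σ → Invariant σ
  entry σ (lift eq , u) = U⊨I σ u , continues
    where
    continues : Continues σ
    continues τ its hτ σ' dτ ne =
      prepend-dup {U} {(Iteration †) ** ⟪ ¬ₑ e ⟫} (subst U eq u)
        (append dτ ⟨ σ' ⟩ ,
         append-chop {Iteration †} {⟪ ¬ₑ e ⟫} its dτ (lift refl , ne) refl ,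
         lift (trans (append-hd dτ refl) (trans hτ eq)) , append-↓ dτ (↓⟨⟩ refl))

  -- A body run from σ₁ to σ is one more iteration: it re-establishes I, and
  -- the continuation at σ₁ extended by that iteration is one at σ.
  step : ∀ σ σ₁ → Continues σ₁ → LastFrom (P ** ⟪ I ⟫) σ₁ σ → Invariant σ
  step σ σ₁ continues₁ (_ , (ρ , p , fol) , lift h , d) with follows-last {I} fol d
  ... | (dρ , iσ , same-hd) = iσ , continues
    where
    iteration : Trace
    iteration = append dρ (σ ∷ ⟨ σ ⟩)
    is-iteration : pred Iteration iteration
    is-iteration = append-chop {P} {dupᵗ I} p dρ (iσ , lift (refl , refl)) refl
    iteration-↓ : iteration ↓ σ
    iteration-↓ = append-↓ dρ (dup-↓ σ)
    continues : Continues σ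
    continues τ its hτ σ' dτ ne =
      continues₁ (append iteration-↓ τ)
        (dagger-cons {Iteration} is-iteration iteration-↓ its hτ)
        (trans (append-hd iteration-↓ hτ) (trans (append-hd dρ refl) (trans same-hd h)))
        σ' (append-↓ iteration-↓ dτ) ne

  invariant-preserved : ⊢ˢ[ e ∧ˢ Invariant ] sₜ [ Invariant ]
  invariant-preserved =
    conseqˢ (λ σ (b , i , c) → σ , c , lift refl , b , i)
      (existsˢ {Z = State} (λ σ₁ → frame (Continues σ₁) (from body σ₁)))
      (λ σ (σ₁ , c , lf) → step σ σ₁ c lf)

  -- On exit the continuation is applied to zero further iterations.
  exit : ∀ σ → (Invariant ∧¬ˢ e) σ → LastFrom Loop σ₀ σ
  exit σ ((_ , continues) , ne) =
    continues ⟨ σ ⟩ (dagger-nil {Iteration}) refl σ (↓⟨⟩ refl) ne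

  rooted : ⊢ˢ[ At U σ₀ ] (while e loop sₜ) [ LastFrom Loop σ₀ ]
  rooted = conseqˢ entry (whileˢ invariant-preserved) exit

rooted-while : ∀ {U I P e sₜ} → U ⊨ˢ I → Rooted (e ∧ˢ I) sₜ (P ** ⟪ I ⟫) →
  Rooted U (while e loop sₜ) (dupᵗ U ** ((P ** dupᵗ I) †) ** ⟪ ¬ₑ e ⟫)
from (rooted-while {P = P} U⊨I body) σ₀ = WhileCase.rooted {P = P} U⊨I body σ₀

rooted-conseq : ∀ {U U' P P' s} → U ⊨ˢ U' → Rooted U' s P' → P' ⊨ᵗ P → Rooted U s P
from (rooted-conseq U⊨U' d P'⊨P) σ₀ =
  conseqˢ (λ σ (eq , u) → eq , U⊨U' σ u) (from d σ₀)
    (λ σ (τ , p , h , dτ) → τ , P'⊨P τ p , h , dτ)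

rooted-exists : ∀ {Z : Set} {U : Z → SPred} {P : Z → TPred} {s} →
  (∀ z → Rooted (U z) s (P z)) → Rooted (∃ˢ Z U) s (∃ᵗ Z P)
from (rooted-exists d) σ₀ =
  conseqˢ (λ σ (eq , z , u) → z , eq , u) (existsˢ (λ z → from (d z) σ₀))
    (λ σ (z , τ , p , h , dτ) → τ , (z , p) , h , dτ)

rooted : ∀ {U s P} → ⊢ᵗ[ U ] s [ P ] → Rooted U s P
rooted assignᵗ = rooted-assign
rooted skipᵗ = rooted-skip
rooted (seqᵗ {P = P} d₀ d₁) = rooted-seq {P = P} (rooted d₀) (rooted d₁)
rooted (ifᵗ dₜ d_f) = rooted-if (rooted dₜ) (rooted d_f)
rooted (whileᵗ {P = P} U⊨I d) = rooted-while {P = P} U⊨I (rooted d)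
rooted (conseqᵗ U⊨U' d P'⊨P) = rooted-conseq U⊨U' (rooted d) P'⊨P
rooted (existsᵗ d) = rooted-exists (λ z → rooted (d z))

corollary4p5 : (s : Stmt) (U : SPred) (P : TPred) →
    ⊢ᵗ[ U ] s [ P ] → ⊢ˢ[ U ] s [ Last P ]
corollary4p5 s U P d =
  conseqˢ (λ σ u → σ , lift refl , u) (existsˢ {Z = State} (λ σ₀ → from (rooted d) σ₀))
    (λ σ (σ₀ , τ , p , _ , dτ) → τ , p , dτ)
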